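{- Let $k\ge 2$ and $W\in\mathcal M^2_{(3k+2)\times 5}$, and call the sub-words $W[\![6,8]\!],W[\![9,11]\!],\dots,W[\![3k-3,3k-1]\!]$ (each formed by three consecutive rows) the interior tiles of $W$. Assume that, for every $h'<3k+2$, every sub-word of $W$ formed by $h'$ consecutive rows has excess at most $\hat e_{max}(h',5)$. Then (i) no interior tile of $W$ has excess greater than or equal to $1$; (ii) $e(W[\![1,5]\!])=1/3$ and $e(W[\![3k,3k+2]\!])=1$; (iii) no interior tile of $W$ has excess $-1$.
   Context: A 2-dimensional binary word of dimensions $h\times w$ is an $h\times w$ matrix $W$ with entries in $\{\square,\blacksquare\}$ (filled cells $\blacksquare$, empty cells $\square$); $|W|_\blacksquare$ is its number of filled cells. Positions $(i,j),(i',j')$ are adjacent if $|i-i'|+|j-j'|=1$; the degree of a filled cell is the number of filled cells adjacent to it. $\mathcal W^2_{h\times w}$ is the set of $h\times w$ words in which every filled cell has degree at most $2$; $\max_2(h,w)$ is the maximum of $|W|_\blacksquare$ over $\mathcal W^2_{h\times w}$, and $\mathcal M^2_{h\times w}$ is the set of $W\in\mathcal W^2_{h\times w}$ with $|W|_\blacksquare=\max_2(h,w)$. $W[\![i,i']\!]$ denotes the sub-word formed by rows $i$ through $i'$. The excess of an $a\times b$ word $V$ is $e(V)=|V|_\blacksquare-2ab/3$ (computed with the dimensions of $V$ itself). For positive integers $a\ge b$, $\hat e_{max}(a,b)$ equals $ab/3$ if $b=1$ or $a=b=2$; $ab/12$ if $a$ is even, $a\ge4$, $b=2$; $ab/12+1/2$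 if $a$ is odd, $a\ge 3$, $b=2$; $2$ if $b=3$ or $a\equiv b\equiv 0\pmod 3$; $4/3$ if $b\ge 4$ and $a\equiv b\not\equiv 0\pmod 3$; $1$ if $b\ge4$, $ab\equiv 0 \pmod 3$ and $a\not\equiv b\pmod 3$; and $2/3$ otherwise. For $a<b$, $\hat e_{max}(a,b)=\hat e_{max}(b,a)$. -}

module Defs where

open import Data.Bool using (Bool; true; false)
open import Data.Nat using (ℕ; zero; suc; _+_; _*_; _≤_; _<_; _<?_; _≤?_; _≟_; _%_)
open import Data.Nat.Properties using (+-monoʳ-<; <-≤-trans; +-comm)
open import Data.Fin using (Fin; toℕ; fromℕ<)
import Data.Fin as F
open import Data.Product using (_×_)
open import Data.Fin.Properties using (toℕ<n)
open import Data.Integer using (+_)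
open import Data.Rational using (ℚ; _/_) renaming (_-_ to _-ℚ_; _+_ to _+ℚ_)
open import Relation.Nullary using (yes; no)
open import Relation.Binary.PropositionalEquality using (_≡_; subst)

-- A 2-dimensional binary word of dimensions h × w: true = filled, false = empty.
Word : ℕ → ℕ → Set
Word h w = Fin h → Fin w → Bool

b2n : Bool → ℕ
b2n true  = 1
b2n false = 0

∑ : (n : ℕ) → (Fin n → ℕ) → ℕ
∑ zero    f = 0
∑ (suc n) f = f F.zero + ∑ n (λ i → f (F.suc i))

filled : ∀ {h w} → Word h w → ℕ
filled {h} {w} W = ∑ h (λ i → ∑ w (λ j → b2n (W i j)))

at : ∀ {h w} → Word h w → ℕ → ℕ → Bool
at {h} {w} W i j with i <? h | j <? w
... | yes p | yes q = W (fromℕ< p) (fromℕ< q)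
... | _     | _     = false

adjFilled : ∀ {h w} → Word h w → ℕ → ℕ → ℕ
adjFilled W i j = b2n (at W (suc i) j) + b2n (at W i (suc j)) + up i + left j
  where
  up : ℕ → ℕ
  up zero    = 0
  up (suc i') = b2n (at W i' j)
  left : ℕ → ℕ
  left zero     = 0
  left (suc j') = b2n (at W i j')

InW2 : ∀ {h w} → Word h w → Set
InW2 {h} {w} W = (i : Fin h) (j : Fin w) → W i j ≡ true → adjFilled W (toℕ i) (toℕ j) ≤ 2

-- W ∈ ℳ²_{h×w}: W ∈ 𝒲² and |W|_■ = max₂(h,w), i.e. no word of 𝒲²_{h×w} has more filled cells
InM2 : ∀ {h w} → Word h w → Set
InM2 {h} {w} W = InW2 W × ((V : Word h w) → InW2 V → filled V ≤ filled W)

-- sub-word formed by the len consecutive rows starting at 0-based row s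
-- (so W⟦i,i'⟧ = sub W (i - 1) (i' - i + 1) _)
sub : ∀ {h w} → Word h w → (s len : ℕ) → s + len ≤ h → Word len w
sub W s len p i j = W (fromℕ< (<-≤-trans (+-monoʳ-< s (toℕ<n i)) p)) j

excess : ∀ {a b} → Word a b → ℚ
excess {a} {b} V = (+ filled V / 1) -ℚ (+ (2 * a * b) / 3)

emaxOrd : ℕ → ℕ → ℚ
emaxOrd a 1 = + (a * 1) / 3
emaxOrd a 2 with a ≟ 2 | a % 2
... | yes _ | _     = + (a * 2) / 3
... | no _  | zero  = + (a * 2) / 12
... | no _  | suc _ = (+ (a * 2) / 12) +ℚ (+ 1 / 2)
emaxOrd a 3 = + 2 / 1
emaxOrd a b = rest (a % 3) (b % 3) ((a * b) % 3)
  where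
  rest : ℕ → ℕ → ℕ → ℚ
  rest zero    zero    _       = + 2 / 1
  rest (suc x) (suc y) _ with x ≟ y
  ... | yes _ = + 4 / 3
  ... | no _  = + 2 / 3
  rest _       _       zero    = + 1 / 1
  rest _       _       (suc _) = + 2 / 3

emax : ℕ → ℕ → ℚ
emax a b with b ≤? a
... | yes _ = emaxOrd a b
... | no _  = emaxOrd b a

module Submission where

-- The excess hypothesis caps every strip of 3u + ρ consecutive rows at 10u + surplus u ρ
-- filled cells, while an explicit word shows max₂(3k + 2, 5) ≥ 10k + 8.  Comparing prefixes
-- and suffixes of W, the number S x of filled cells in its first x rows is confined to an
-- interval of width at most two for every x, and |W| = 10k + 8.  An exhaustive search over
-- the rows of a window of at most 14 consecutive rows, pruned by these intervals and by the
-- degree bound, shows S (3t + 2) = 10t + 7: for t = 1, 2 below the empty top border, and for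
-- t + 2 from t and t + 1.  So every interior tile has 10 filled cells (excess 0), the first
-- five rows have 17 (excess 1/3) and the last three rows 11 (excess 1).

open import Defs
open import Data.Bool using (Bool; true; false; _∧_; _∨_; not; T; if_then_else_)
open import Data.Bool.ListAction using (all)
open import Data.Bool.Properties using (T-∧; T-∨)
open import Data.Empty using (⊥-elim)
open import Data.Fin using (Fin; toℕ; fromℕ<; opposite)
import Data.Fin as Fin
open import Data.Fin.Patterns using (0F; 1F; 2F)
open import Data.Fin.Properties using (toℕ<n; toℕ-fromℕ<; fromℕ<-toℕ)
open import Data.Integer using (+_; -[1+_])
import Data.Integer as ℤ
import Data.Integer.Properties as ℤP
open import Data.Integer.Tactic.RingSolver renaming (solve-∀ to ℤ-solve-∀)
open import Data.List using (List; []; _∷_; upTo)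
open import Data.List.Relation.Unary.All.Properties using (all⁺; all⁻; applyUpTo⁺₁; applyUpTo⁻)
open import Data.Maybe using (Maybe; just; nothing)
open import Data.Nat
  using (ℕ; zero; suc; _+_; _*_; _∸_; _%_; _≤_; _<_; _≤ᵇ_; _<ᵇ_; _≡ᵇ_; _<?_; _≤?_; _≟_; z≤n; s≤s)
open import Data.Nat.DivMod using ([m+kn]%n≡m%n)
open import Data.Nat.Properties
open import Data.Nat.Tactic.RingSolver using (solve-∀)
open import Data.Product using (_×_; _,_; proj₁; ∃₂)
import Data.Rational as ℚ
open import Data.Rational using (_/_; toℚᵘ; 1ℚ) renaming (_≤_ to _≤ℚ_; _-_ to _-ℚ_)
import Data.Rational.Properties as ℚP
import Data.Rational.Unnormalised as ℚᵘ
open import Data.Rational.Unnormalised using (mkℚᵘ) renaming (_≃_ to _≃ᵘ_)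
import Data.Rational.Unnormalised.Properties as ℚᵘP
open import Data.Sum using (_⊎_; inj₁; inj₂; [_,_])
open import Data.Unit using (⊤; tt)
open import Data.Vec using (Vec; []; _∷_; replicate; tabulate; lookup)
open import Data.Vec.Properties using (tabulate-cong; tabulate∘lookup; lookup-replicate)
open import Function using (_∘_; id)
open import Function.Bundles using (Equivalence)
open import Relation.Binary.PropositionalEquality
  using (_≡_; _≢_; refl; sym; trans; cong; cong₂; subst; subst₂; module ≡-Reasoning)
open import Relation.Nullary using (¬_; Dec; yes; no; contradiction)
open import Relation.Nullary.Decidable using (decidable-stable)

sumTo : ℕ → (ℕ → ℕ) → ℕ
sumTo zero    f = 0
sumTo (suc n) f = f 0 + sumTo n (f ∘ suc)

sumTo-+ : ∀ m n f → sumTo (m + n) f ≡ sumTo m f + sumTo n (λ i → f (m + i))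
sumTo-+ zero    n f = refl
sumTo-+ (suc m) n f = trans (cong (_+_ (f 0)) (sumTo-+ m n (f ∘ suc))) (sym (+-assoc (f 0) _ _))

sumTo-suc : ∀ n f → sumTo (suc n) f ≡ sumTo n f + f n
sumTo-suc zero    f = +-comm (f 0) 0
sumTo-suc (suc n) f = trans (cong (_+_ (f 0)) (sumTo-suc n (f ∘ suc))) (sym (+-assoc (f 0) _ _))

sumTo-cong : ∀ n {f g} → (∀ i → f i ≡ g i) → sumTo n f ≡ sumTo n g
sumTo-cong zero    f≗g = refl
sumTo-cong (suc n) f≗g = cong₂ _+_ (f≗g 0) (sumTo-cong n (f≗g ∘ suc))

sumTo-zero : ∀ n {f} → (∀ i → f i ≡ 0) → sumTo n f ≡ 0
sumTo-zero zero    f≗0 = refl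
sumTo-zero (suc n) f≗0 = cong₂ _+_ (f≗0 0) (sumTo-zero n (f≗0 ∘ suc))

∑-cong : ∀ n {f g : Fin n → ℕ} → (∀ i → f i ≡ g i) → ∑ n f ≡ ∑ n g
∑-cong zero    f≗g = refl
∑-cong (suc n) f≗g = cong₂ _+_ (f≗g Fin.zero) (∑-cong n (f≗g ∘ Fin.suc))

∑≡sumTo : ∀ n (f : ℕ → ℕ) → ∑ n (f ∘ toℕ) ≡ sumTo n f
∑≡sumTo zero    f = refl
∑≡sumTo (suc n) f = cong (_+_ (f 0)) (∑≡sumTo n (f ∘ suc))

Row : ℕ → Set
Row = Vec Bool

emptyRow : ∀ {w} → Row w
emptyRow = replicate _ false

cell : ∀ {w} → Row w → ℕ → Bool
cell []      _       = false
cell (b ∷ _) zero    = b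
cell (_ ∷ r) (suc j) = cell r j

population : ∀ {w} → Row w → ℕ
population []      = 0
population (b ∷ r) = b2n b + population r

-- Summed in the order of adjFilled, which then agrees with it term by term.
degree : ∀ {w} → Row w → Row w → Row w → ℕ → ℕ
degree above c below j = b2n (cell below j) + b2n (cell c (suc j)) + b2n (cell above j) + left j
  where
  left : ℕ → ℕ
  left zero    = 0
  left (suc i) = b2n (cell c i)

cellValid : ∀ {w} → Row w → Row w → Row w → ℕ → Bool
cellValid above c below j = not (cell c j) ∨ (degree above c below j ≤ᵇ 2)

rowValid : ∀ {w} → Row w → Row w → Row w → Bool
rowValid {w} above c below = all (cellValid above c below) (upTo w)

anyRow : ∀ w → (Row w → Bool) → Bool
anyRow zero    f = f []
anyRow (suc w) f = anyRow w (f ∘ (true ∷_)) ∨ anyRow w (f ∘ (false ∷_))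

cell-emptyRow : ∀ w j → cell (emptyRow {w}) j ≡ false
cell-emptyRow zero    j       = refl
cell-emptyRow (suc w) zero    = refl
cell-emptyRow (suc w) (suc j) = cell-emptyRow w j

population-emptyRow : ∀ w → population (emptyRow {w}) ≡ 0
population-emptyRow zero    = refl
population-emptyRow (suc w) = population-emptyRow w

cell-tabulate : ∀ {w} (g : ℕ → Bool) → (∀ j → w ≤ j → g j ≡ false) →
                ∀ j → cell (tabulate {n = w} (g ∘ toℕ)) j ≡ g j
cell-tabulate {zero}  g g-out j       = sym (g-out j z≤n)
cell-tabulate {suc w} g g-out zero    = refl
cell-tabulate {suc w} g g-out (suc j) = cell-tabulate (g ∘ suc) (λ i w≤i → g-out (suc i) (s≤s w≤i)) j

population-tabulate : ∀ {w} (f : Fin w → Bool) → population (tabulate f) ≡ ∑ w (b2n ∘ f)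
population-tabulate {zero}  f = refl
population-tabulate {suc w} f = cong (_+_ (b2n (f Fin.zero))) (population-tabulate (f ∘ Fin.suc))

rowValid-sound : ∀ {w} (above c below : Row w) → T (rowValid above c below) →
                 ∀ j → j < w → cell c j ≡ true → degree above c below j ≤ 2
rowValid-sound {w} above c below valid j j<w =
  cellValid⇒ (applyUpTo⁻ id w (all⁺ (cellValid above c below) (upTo w) valid) j<w)
  where
  cellValid⇒ : T (cellValid above c below j) → cell c j ≡ true → degree above c below j ≤ 2
  cellValid⇒ ok filled with cell c j
  cellValid⇒ ok refl | true = ≤ᵇ⇒≤ _ 2 ok

rowValid-complete : ∀ {w} (above c below : Row w) →
                    (∀ j → j < w → cell c j ≡ true → degree above c below j ≤ 2) → T (rowValid above c below)
rowValid-complete {w} above c below deg≤2 = all⁻ (cellValid above c below) (applyUpTo⁺₁ id w valid)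
  where
  valid : ∀ {j} → j < w → T (cellValid above c below j)
  valid {j} j<w with cell c j in filled
  ... | false = tt
  ... | true  = ≤⇒≤ᵇ (deg≤2 j j<w filled)

rowValid-emptyRow : ∀ {w} (above below : Row w) → T (rowValid above emptyRow below)
rowValid-emptyRow {w} above below = rowValid-complete above emptyRow below λ j _ filled →
  contradiction (trans (sym (cell-emptyRow w j)) filled) λ ()

anyRow-complete : ∀ {w} (f : Row w → Bool) (r : Row w) → T (f r) → T (anyRow w f)
anyRow-complete f []          fr = fr
anyRow-complete f (true ∷ r)  fr = Equivalence.from T-∨ (inj₁ (anyRow-complete (f ∘ (true ∷_)) r fr))
anyRow-complete f (false ∷ r) fr = Equivalence.from T-∨ (inj₂ (anyRow-complete (f ∘ (false ∷_)) r fr))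

rowAbove : ∀ {w} → (ℕ → Row w) → ℕ → Row w
rowAbove R zero    = emptyRow
rowAbove R (suc x) = R x

-- Words as sequences of rows

+-cong₄ : ∀ {a b c d a′ b′ c′ d′} → a ≡ a′ → b ≡ b′ → c ≡ c′ → d ≡ d′ →
          a + b + c + d ≡ a′ + b′ + c′ + d′
+-cong₄ refl refl refl refl = refl

module _ {h w} (W : Word h w) where

  row : ℕ → Row w
  row x = tabulate (λ j → at W x (toℕ j))

  at-inside : ∀ {x} (x<h : x < h) j → at W x (toℕ j) ≡ W (fromℕ< x<h) j
  at-inside {x} x<h j with x <? h | toℕ j <? w
  ... | yes _  | yes j<w = cong (W (fromℕ< x<h)) (fromℕ<-toℕ j j<w)
  ... | no x≮h | _       = ⊥-elim (x≮h x<h)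
  ... | yes _  | no j≮w  = ⊥-elim (j≮w (toℕ<n j))

  at-outside : ∀ x j → h ≤ x ⊎ w ≤ j → at W x j ≡ false
  at-outside x j outside with x <? h | j <? w
  ... | yes x<h | yes j<w = ⊥-elim ([ <⇒≱ x<h , <⇒≱ j<w ] outside)
  ... | no _    | _       = refl
  ... | yes _   | no _    = refl

  at-true : ∀ x j → at W x j ≡ true →
            ∃₂ λ (x<h : x < h) (j<w : j < w) → W (fromℕ< x<h) (fromℕ< j<w) ≡ true
  at-true x j filled with x <? h | j <? w
  ... | yes x<h | yes j<w = x<h , j<w , filled

  at≡cell-row : ∀ x j → at W x j ≡ cell (row x) j
  at≡cell-row x j = sym (cell-tabulate (at W x) (λ j w≤j → at-outside x j (inj₂ w≤j)) j)

  row-outside : ∀ x → h ≤ x → row x ≡ emptyRow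
  row-outside x h≤x =
    trans (tabulate-cong λ j → trans (at-outside x (toℕ j) (inj₁ h≤x)) (sym (lookup-replicate j false)))
          (tabulate∘lookup emptyRow)

  b2n-at : ∀ x j → b2n (at W x j) ≡ b2n (cell (row x) j)
  b2n-at x j = cong b2n (at≡cell-row x j)

  b2n-empty : ∀ j → 0 ≡ b2n (cell (emptyRow {w}) j)
  b2n-empty j = cong b2n (sym (cell-emptyRow w j))

  adjFilled≡degree : ∀ x j → adjFilled W x j ≡ degree (rowAbove row x) (row x) (row (suc x)) j
  adjFilled≡degree zero    zero    = +-cong₄ (b2n-at 1 0) (b2n-at 0 1) (b2n-empty 0) refl
  adjFilled≡degree zero    (suc j) = +-cong₄ (b2n-at 1 (suc j)) (b2n-at 0 (2 + j)) (b2n-empty (suc j)) (b2n-at 0 j)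
  adjFilled≡degree (suc x) zero    = +-cong₄ (b2n-at (2 + x) 0) (b2n-at (suc x) 1) (b2n-at x 0) refl
  adjFilled≡degree (suc x) (suc j) =
    +-cong₄ (b2n-at (2 + x) (suc j)) (b2n-at (suc x) (2 + j)) (b2n-at x (suc j)) (b2n-at (suc x) j)

  population-row : ∀ {x} (x<h : x < h) → population (row x) ≡ ∑ w (λ j → b2n (W (fromℕ< x<h) j))
  population-row {x} x<h =
    trans (population-tabulate {w} (λ j → at W x (toℕ j))) (∑-cong w λ j → cong b2n (at-inside x<h j))

  filled-sub : ∀ s len (le : s + len ≤ h) → filled (sub W s len le) ≡ sumTo len (λ i → population (row (s + i)))
  filled-sub s len le = trans (∑-cong len λ i → sym (population-row (<-≤-trans (+-monoʳ-< s (toℕ<n i)) le)))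
                              (∑≡sumTo len (λ i → population (row (s + i))))

  filled-rows : filled W ≡ sumTo h (population ∘ row)
  filled-rows =
    trans (∑-cong h λ i → ∑-cong w λ j → cong (λ i′ → b2n (W i′ j)) (sym (fromℕ<-toℕ i (toℕ<n i))))
          (filled-sub 0 h ≤-refl)

  InW2⇒rowValid : InW2 W → ∀ x → T (rowValid (rowAbove row x) (row x) (row (suc x)))
  InW2⇒rowValid valid x = rowValid-complete (rowAbove row x) (row x) (row (suc x))
    λ j _ filled → deg≤2 j (trans (at≡cell-row x j) filled)
    where
    deg≤2 : ∀ j → at W x j ≡ true → degree (rowAbove row x) (row x) (row (suc x)) j ≤ 2
    deg≤2 j filled with at-true x j filled
    ... | x<h , j<w , W-filled = subst (_≤ 2) (adjFilled≡degree x j)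
      (subst₂ (λ x′ j′ → adjFilled W x′ j′ ≤ 2) (toℕ-fromℕ< x<h) (toℕ-fromℕ< j<w) (valid _ _ W-filled))

  rowValid⇒InW2 : (∀ x → T (rowValid (rowAbove row x) (row x) (row (suc x)))) → InW2 W
  rowValid⇒InW2 valid i j filled = subst (_≤ 2) (sym (adjFilled≡degree (toℕ i) (toℕ j)))
    (rowValid-sound (rowAbove row (toℕ i)) (row (toℕ i)) (row (suc (toℕ i))) (valid (toℕ i)) (toℕ j) (toℕ<n j)
      (trans (sym (at≡cell-row (toℕ i) (toℕ j))) (trans (at-inside (toℕ<n i) j)
        (trans (cong (λ i′ → W i′ j) (fromℕ<-toℕ i (toℕ<n i))) filled))))

fromRows : ∀ {h w} → (ℕ → Row w) → Word h w
fromRows R i j = lookup (R (toℕ i)) j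

module _ {h w} (R : ℕ → Row w) (R-outside : ∀ x → h ≤ x → R x ≡ emptyRow) where

  row-fromRows : ∀ x → row (fromRows {h} R) x ≡ R x
  row-fromRows x = by-cases (x <? h)
    where
    by-cases : Dec (x < h) → row (fromRows {h} R) x ≡ R x
    by-cases (yes x<h) = trans (tabulate-cong λ j → trans (at-inside (fromRows R) x<h j)
                                                      (cong (λ y → lookup (R y) j) (toℕ-fromℕ< x<h)))
                               (tabulate∘lookup (R x))
    by-cases (no x≮h)  = trans (row-outside (fromRows R) x (≮⇒≥ x≮h)) (sym (R-outside x (≮⇒≥ x≮h)))

  fromRows-InW2 : (∀ x → T (rowValid (rowAbove R x) (R x) (R (suc x)))) → InW2 (fromRows {h} R)
  fromRows-InW2 R-valid = rowValid⇒InW2 (fromRows R) λ x →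
    subst T (sym (cong₃ rowValid (above-fromRows x) (row-fromRows x) (row-fromRows (suc x)))) (R-valid x)
    where
    above-fromRows : ∀ x → rowAbove (row (fromRows {h} R)) x ≡ rowAbove R x
    above-fromRows zero    = refl
    above-fromRows (suc x) = row-fromRows x
    cong₃ : ∀ {A B C D : Set} (f : A → B → C → D) {a a′ b b′ c c′} →
            a ≡ a′ → b ≡ b′ → c ≡ c′ → f a b c ≡ f a′ b′ c′
    cong₃ f refl refl refl = refl

  filled-fromRows : filled (fromRows {h} R) ≡ sumTo h (population ∘ R)
  filled-fromRows = trans (filled-rows (fromRows {h} R)) (sumTo-cong h (cong population ∘ row-fromRows))

periodicRows : ℕ → ℕ → Row 5
periodicRows zero    zero                = true ∷ false ∷ true ∷ true ∷ true ∷ []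
periodicRows zero    (suc _)             = emptyRow
periodicRows (suc k) zero                = true ∷ false ∷ true ∷ true ∷ false ∷ []
periodicRows (suc k) (suc zero)          = true ∷ true ∷ false ∷ true ∷ true ∷ []
periodicRows (suc k) (suc (suc zero))    = false ∷ true ∷ true ∷ false ∷ true ∷ []
periodicRows (suc k) (suc (suc (suc x))) = periodicRows k x

extremalRows : ℕ → ℕ → Row 5
extremalRows k zero    = true ∷ true ∷ true ∷ false ∷ true ∷ []
extremalRows k (suc x) = periodicRows k x

periodicRows-valid : ∀ k x → T (rowValid (periodicRows k x) (periodicRows k (1 + x)) (periodicRows k (2 + x)))
periodicRows-valid zero          x                   = rowValid-emptyRow (periodicRows 0 x) emptyRow
periodicRows-valid (suc k)       zero                = tt
periodicRows-valid (suc zero)    (suc zero)          = tt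
periodicRows-valid (suc (suc k)) (suc zero)          = tt
periodicRows-valid (suc zero)    (suc (suc zero))    = tt
periodicRows-valid (suc (suc k)) (suc (suc zero))    = tt
periodicRows-valid (suc k)       (suc (suc (suc x))) = periodicRows-valid k x

extremalRows-valid : ∀ k x → T (rowValid (rowAbove (extremalRows k) x) (extremalRows k x) (extremalRows k (suc x)))
extremalRows-valid zero    zero          = tt
extremalRows-valid (suc k) zero          = tt
extremalRows-valid zero    (suc zero)    = tt
extremalRows-valid (suc k) (suc zero)    = tt
extremalRows-valid k       (suc (suc x)) = periodicRows-valid k x

periodicRows-beyond : ∀ k y → periodicRows k (3 * k + 1 + y) ≡ emptyRow
periodicRows-beyond zero    y = refl
periodicRows-beyond (suc k) y = trans (cong (periodicRows (suc k)) (period k y)) (periodicRows-beyond k y)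
  where
  period : ∀ k y → 3 * suc k + 1 + y ≡ 3 + (3 * k + 1 + y)
  period = solve-∀

extremalRows-outside : ∀ k x → 3 * k + 2 ≤ x → extremalRows k x ≡ emptyRow
extremalRows-outside k zero    le = contradiction (m+n≤o⇒n≤o (3 * k) le) λ ()
extremalRows-outside k (suc x) le =
  trans (cong (periodicRows k) (sym (m+[n∸m]≡n 3k+1≤x))) (periodicRows-beyond k (x ∸ (3 * k + 1)))
  where
  3k+1≤x : 3 * k + 1 ≤ x
  3k+1≤x = ≤-pred (subst (_≤ suc x) (+-suc (3 * k) 1) le)

periodicRows-count : ∀ k → sumTo (3 * k + 1) (population ∘ periodicRows k) ≡ 10 * k + 4
periodicRows-count zero    = refl
periodicRows-count (suc k) = begin
  sumTo (3 * suc k + 1) (population ∘ periodicRows (suc k))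
    ≡⟨ cong (λ n → sumTo n (population ∘ periodicRows (suc k))) (period k) ⟩
  10 + sumTo (3 * k + 1) (population ∘ periodicRows k)
    ≡⟨ cong (_+_ 10) (periodicRows-count k) ⟩
  10 + (10 * k + 4)
    ≡⟨ count k ⟩
  10 * suc k + 4 ∎
  where
  open ≡-Reasoning
  period : ∀ k → 3 * suc k + 1 ≡ 3 + (3 * k + 1)
  period = solve-∀
  count : ∀ k → 10 + (10 * k + 4) ≡ 10 * suc k + 4
  count = solve-∀

extremal : ∀ k → Word (3 * k + 2) 5
extremal k = fromRows (extremalRows k)

filled-extremal : ∀ k → filled (extremal k) ≡ 10 * k + 8
filled-extremal k = begin
  filled (extremal k)
    ≡⟨ filled-fromRows (extremalRows k) (extremalRows-outside k) ⟩
  sumTo (3 * k + 2) (population ∘ extremalRows k)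
    ≡⟨ cong (λ n → sumTo n (population ∘ extremalRows k)) (+-suc (3 * k) 1) ⟩
  4 + sumTo (3 * k + 1) (population ∘ periodicRows k)
    ≡⟨ cong (_+_ 4) (periodicRows-count k) ⟩
  4 + (10 * k + 4)
    ≡⟨ count k ⟩
  10 * k + 8 ∎
  where
  open ≡-Reasoning
  count : ∀ k → 4 + (10 * k + 4) ≡ 10 * k + 8
  count = solve-∀

InM2⇒10k+8≤filled : ∀ k (W : Word (3 * k + 2) 5) → InM2 W → 10 * k + 8 ≤ filled W
InM2⇒10k+8≤filled k W (_ , maximal) = subst (_≤ filled W) (filled-extremal k)
  (maximal (extremal k) (fromRows-InW2 (extremalRows k) (extremalRows-outside k) (extremalRows-valid k)))

-- Capacity of strips of width 5

-- ⌊10ρ/3 + ê_max(3u + ρ, 5)⌋: a strip of 3u + ρ rows with excess at most ê_max has at most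
-- 10u + surplus u ρ filled cells.
surplus : ℕ → Fin 3 → ℕ
surplus _             2F = 8
surplus zero          1F = 5
surplus (suc _)       1F = 4
surplus zero          0F = 0
surplus (suc zero)    0F = 2
surplus (suc (suc _)) 0F = 1

surplus≤8 : ∀ u ρ → surplus u ρ ≤ 8
surplus≤8 _             2F = ≤-refl
surplus≤8 zero          1F = ≤ᵇ⇒≤ 5 8 tt
surplus≤8 (suc _)       1F = ≤ᵇ⇒≤ 4 8 tt
surplus≤8 zero          0F = z≤n
surplus≤8 (suc zero)    0F = ≤ᵇ⇒≤ 2 8 tt
surplus≤8 (suc (suc _)) 0F = ≤ᵇ⇒≤ 1 8 tt

toℚᵘ-/ : ∀ n e → toℚᵘ (+ n / suc e) ≃ᵘ mkℚᵘ (+ n) e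
toℚᵘ-/ n e = ℚP.toℚᵘ-fromℚᵘ (mkℚᵘ (+ n) e)

clear-denominators : ∀ n a c e → (+ n / 1) -ℚ (+ a / 3) ≤ℚ + c / suc e → n * 3 * suc e ≤ c * 3 + a * suc e
clear-denominators n a c e le =
  ℤP.drop‿+≤+ (subst₂ ℤ._≤_ lhs rhs (ℤP.+-monoˡ-≤ (+ a ℤ.* + suc e) cross-multiplied))
  where
  difference : toℚᵘ ((+ n / 1) -ℚ (+ a / 3)) ≃ᵘ mkℚᵘ (+ n) 0 ℚᵘ.+ ℚᵘ.- mkℚᵘ (+ a) 2
  difference = ℚᵘP.≃-trans (ℚP.toℚᵘ-homo-+ (+ n / 1) (ℚ.- (+ a / 3)))
    (ℚᵘP.+-cong (toℚᵘ-/ n 0) (ℚᵘP.≃-trans (ℚP.toℚᵘ-homo‿- (+ a / 3)) (ℚᵘP.-‿cong (toℚᵘ-/ a 2))))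
  cross-multiplied : (+ n ℤ.* + 3 ℤ.+ ℤ.- (+ a) ℤ.* + 1) ℤ.* + suc e ℤ.≤ + c ℤ.* + 3
  cross-multiplied with ℚᵘP.≤-respʳ-≃ (toℚᵘ-/ c e) (ℚᵘP.≤-respˡ-≃ difference (ℚP.toℚᵘ-mono-≤ le))
  ... | ℚᵘ.*≤* le′ = le′
  regroup : ∀ x y z → (x ℤ.* + 3 ℤ.+ ℤ.- y ℤ.* + 1) ℤ.* z ℤ.+ y ℤ.* z ≡ x ℤ.* + 3 ℤ.* z
  regroup = ℤ-solve-∀
  lhs : (+ n ℤ.* + 3 ℤ.+ ℤ.- (+ a) ℤ.* + 1) ℤ.* + suc e ℤ.+ + a ℤ.* + suc e ≡ + (n * 3 * suc e)
  lhs = trans (regroup (+ n) (+ a) (+ suc e))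
              (trans (cong (ℤ._* + suc e) (sym (ℤP.pos-* n 3))) (sym (ℤP.pos-* (n * 3) (suc e))))
  rhs : + c ℤ.* + 3 ℤ.+ + a ℤ.* + suc e ≡ + (c * 3 + a * suc e)
  rhs = trans (cong₂ ℤ._+_ (sym (ℤP.pos-* c 3)) (sym (ℤP.pos-* a (suc e)))) (sym (ℤP.pos-+ (c * 3) (a * suc e)))

excess≤⇒filled≤ : ∀ {a} (V : Word a 5) n c e → excess V ≤ℚ + c / suc e →
                  c * 3 + 2 * a * 5 * suc e ≡ n * (3 * suc e) → filled V ≤ n
excess≤⇒filled≤ {a} V n c e le exact = *-cancelʳ-≤ (filled V) n (3 * suc e)
  (subst₂ _≤_ (*-assoc (filled V) 3 (suc e)) exact (clear-denominators (filled V) (2 * a * 5) c e le))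

emax-5 : ∀ a → 5 ≤ a → emax a 5 ≡ emaxOrd a 5
emax-5 a 5≤a with 5 ≤? a
... | yes _   = refl
... | no 5≰a = contradiction 5≤a 5≰a

emaxOrd-%0 : ∀ a → a % 3 ≡ 0 → (a * 5) % 3 ≡ 0 → emaxOrd a 5 ≡ + 1 / 1
emaxOrd-%0 a a%3 a*5%3 rewrite a%3 | a*5%3 = refl

emaxOrd-%1 : ∀ a → a % 3 ≡ 1 → emaxOrd a 5 ≡ + 2 / 3
emaxOrd-%1 a a%3 rewrite a%3 = refl

emaxOrd-%2 : ∀ a → a % 3 ≡ 2 → emaxOrd a 5 ≡ + 4 / 3
emaxOrd-%2 a a%3 rewrite a%3 = refl

[3u+r]%3≡r%3 : ∀ u r → (3 * u + r) % 3 ≡ r % 3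
[3u+r]%3≡r%3 u r = trans (cong (_% 3) (trans (+-comm (3 * u) r) (cong (_+_ r) (*-comm 3 u)))) ([m+kn]%n≡m%n r u 3)

5≤3[2+u]+r : ∀ u r → 5 ≤ 3 * (2 + u) + r
5≤3[2+u]+r u r = ≤-trans (n≤1+n 5) (≤-trans (*-monoʳ-≤ 3 (m≤m+n 2 u)) (m≤m+n _ r))

emax-3u : ∀ u → emax (3 * (2 + u) + 0) 5 ≡ + 1 / 1
emax-3u u = trans (emax-5 _ (5≤3[2+u]+r u 0))
                  (emaxOrd-%0 (3 * (2 + u) + 0) ([3u+r]%3≡r%3 (2 + u) 0) a*5%3)
  where
  times5 : ∀ u → (3 * (2 + u) + 0) * 5 ≡ 3 * ((2 + u) * 5) + 0
  times5 = solve-∀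
  a*5%3 : ((3 * (2 + u) + 0) * 5) % 3 ≡ 0
  a*5%3 = trans (cong (_% 3) (times5 u)) ([3u+r]%3≡r%3 ((2 + u) * 5) 0)

emax-3u+1 : ∀ u → emax (3 * (2 + u) + 1) 5 ≡ + 2 / 3
emax-3u+1 u = trans (emax-5 _ (5≤3[2+u]+r u 1))
                    (emaxOrd-%1 (3 * (2 + u) + 1) ([3u+r]%3≡r%3 (2 + u) 1))

emax-3u+2 : ∀ u → emax (3 * (1 + u) + 2) 5 ≡ + 4 / 3
emax-3u+2 u = trans (emax-5 (3 * (1 + u) + 2) (+-monoˡ-≤ 2 (*-monoʳ-≤ 3 (s≤s (z≤n {u})))))
                    (emaxOrd-%2 (3 * (1 + u) + 2) ([3u+r]%3≡r%3 (1 + u) 2))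

strip-capacity : ∀ u ρ (V : Word (3 * u + toℕ ρ) 5) → 1 ≤ 3 * u + toℕ ρ →
                 excess V ≤ℚ emax (3 * u + toℕ ρ) 5 → filled V ≤ 10 * u + surplus u ρ
strip-capacity 0             1F V _ le = excess≤⇒filled≤ V 5 5 2 le refl
strip-capacity 0             2F V _ le = excess≤⇒filled≤ V 8 4 2 le refl
strip-capacity 1             0F V _ le = excess≤⇒filled≤ V 12 2 0 le refl
strip-capacity 1             1F V _ le = excess≤⇒filled≤ V 14 2 2 le refl
strip-capacity (suc (suc u)) 0F V _ le = excess≤⇒filled≤ V _ 1 0 (subst (excess V ≤ℚ_) (emax-3u u) le) (exact u)
  where
  exact : ∀ u → 1 * 3 + 2 * (3 * (2 + u) + 0) * 5 * 1 ≡ (10 * (2 + u) + 1) * (3 * 1)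
  exact = solve-∀
strip-capacity (suc (suc u)) 1F V _ le = excess≤⇒filled≤ V _ 2 2 (subst (excess V ≤ℚ_) (emax-3u+1 u) le) (exact u)
  where
  exact : ∀ u → 2 * 3 + 2 * (3 * (2 + u) + 1) * 5 * 3 ≡ (10 * (2 + u) + 4) * (3 * 3)
  exact = solve-∀
strip-capacity (suc u)       2F V _ le = excess≤⇒filled≤ V _ 4 2 (subst (excess V ≤ℚ_) (emax-3u+2 u) le) (exact u)
  where
  exact : ∀ u → 4 * 3 + 2 * (3 * (1 + u) + 2) * 5 * 3 ≡ (10 * (1 + u) + 8) * (3 * 3)
  exact = solve-∀

a+[b+n]≤c+[b+s]⇒a+[n∸s]≤c : ∀ {a b c n s} → s ≤ n → a + (b + n) ≤ c + (b + s) → a + (n ∸ s) ≤ c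
a+[b+n]≤c+[b+s]⇒a+[n∸s]≤c {a} {b} {c} {n} {s} s≤n le =
  +-cancelʳ-≤ (b + s) (a + (n ∸ s)) c (subst (_≤ c + (b + s)) regroup le)
  where
  shuffle : ∀ a x b s → a + (b + (x + s)) ≡ a + x + (b + s)
  shuffle = solve-∀
  regroup : a + (b + n) ≡ a + (n ∸ s) + (b + s)
  regroup = trans (cong (λ m → a + (b + m)) (sym (m∸n+n≡m s≤n))) (shuffle a (n ∸ s) b s)

-- Exhaustive search over windows of rows

Constraint : Set
Constraint = ℕ → Bool

between : ℕ → ℕ → Constraint
between l u o = (l ≤ᵇ o) ∧ (o ≤ᵇ u)

exactly : ℕ → Constraint
exactly v = between v v

except : ℕ → Constraint
except v o = not (v ≡ᵇ o)

between-intro : ∀ {l u o} → l ≤ o → o ≤ u → T (between l u o)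
between-intro l≤o o≤u = Equivalence.from T-∧ (≤⇒≤ᵇ l≤o , ≤⇒≤ᵇ o≤u)

exactly-intro : ∀ {v o} → v ≡ o → T (exactly v o)
exactly-intro v≡o = between-intro (≤-reflexive v≡o) (≤-reflexive (sym v≡o))

except-intro : ∀ {v o} → v ≢ o → T (except v o)
except-intro {v} {o} v≢o with v ≡ᵇ o in v≡ᵇo
... | false = tt
... | true  = v≢o (≡ᵇ⇒≡ v o (subst T (sym v≡ᵇo) tt))

refine : ℕ → Constraint → List Constraint → List Constraint
refine _       _ []        = []
refine zero    c (c′ ∷ cs) = (λ o → c o ∧ c′ o) ∷ cs
refine (suc i) c (c′ ∷ cs) = c′ ∷ refine i c cs

validBelow : ∀ {w} → Maybe (Row w) → Maybe (Row w) → Row w → Bool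
validBelow (just above) (just c) below = rowValid above c below
validBelow _            _        _     = true

-- extensible cs p q s: after the rows p, q (when known) and a running count s, some rows
-- r₀, r₁, … make q valid and bring the running count after rᵢ into the i-th constraint.
extensible : ∀ {w} → List Constraint → Maybe (Row w) → Maybe (Row w) → ℕ → Bool
extensible     []       _ _ _ = true
extensible {w} (c ∷ cs) p q s =
  anyRow w λ r → c (s + population r) ∧ validBelow p q r ∧ extensible cs q (just r) (s + population r)

prefixCount : ∀ {w} → (ℕ → Row w) → ℕ → ℕ
prefixCount R x = sumTo x (population ∘ R)

Within : ∀ {w} → (ℕ → Row w) → ℕ → ℕ → List Constraint → Set
Within R base x []       = ⊤
Within R base x (c ∷ cs) = (∀ o → prefixCount R x ≡ base + o → T (c o)) × Within R base (suc x) cs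

within-refine : ∀ {w} (R : ℕ → Row w) base x i c cs → Within R base x cs →
                (∀ o → prefixCount R (i + x) ≡ base + o → T (c o)) → Within R base x (refine i c cs)
within-refine R base x _       c []        _                    _       = tt
within-refine R base x zero    c (c′ ∷ cs) (c′-holds , cs-hold) c-holds =
  (λ o count → Equivalence.from T-∧ (c-holds o count , c′-holds o count)) , cs-hold
within-refine R base x (suc i) c (c′ ∷ cs) (c′-holds , cs-hold) c-holds =
  c′-holds , within-refine R base (suc x) i c cs cs-hold
    (λ o count → c-holds o (trans (cong (prefixCount R) (sym (+-suc i x))) count))

module _ {w} (R : ℕ → Row w) (R-valid : ∀ x → T (rowValid (rowAbove R x) (R x) (R (suc x)))) where

  extensible-complete : ∀ base cs p q x s → prefixCount R x ≡ base + s →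
                        T (validBelow p q (R x)) → T (validBelow q (just (R x)) (R (suc x))) →
                        Within R base (suc x) cs → T (extensible cs p q s)
  extensible-complete base []       p q x s _     _         _       _                  = tt
  extensible-complete base (c ∷ cs) p q x s count p-q-valid q-valid (c-holds , cs-hold) =
    anyRow-complete _ (R x) (Equivalence.from T-∧ (c-holds _ count′ ,
      Equivalence.from T-∧ (p-q-valid ,
        extensible-complete base cs q (just (R x)) (suc x) _ count′ q-valid (R-valid (suc x)) cs-hold)))
    where
    count′ : prefixCount R (suc x) ≡ base + (s + population (R x))
    count′ = trans (sumTo-suc x (population ∘ R)) (trans (cong (_+ population (R x)) count) (+-assoc base s _))

-- allowed m d q ρ: the values of prefixCount at row 3 (q + m) + ρ, minus 10 m, that the strip
-- capacities allow in a word of 3 (m + d) + 2 rows (past its last row the count is the total).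
stripBounds : ℕ → ℕ → ℕ → Fin 3 → Constraint
stripBounds m d q ρ = between (10 * q + (8 ∸ surplus (d ∸ q) (opposite ρ))) (10 * q + surplus (q + m) ρ)

allowed : ℕ → ℕ → ℕ → Fin 3 → Constraint
allowed m d q ρ = if d <ᵇ q then exactly (10 * d + 8) else stripBounds m d q ρ

window : ℕ → ℕ → ℕ → Fin 3 → ℕ → List Constraint
window m d q ρ  zero    = []
window m d q 0F (suc n) = allowed m d q 0F ∷ window m d q 1F n
window m d q 1F (suc n) = allowed m d q 1F ∷ window m d q 2F n
window m d q 2F (suc n) = allowed m d q 2F ∷ window m d (suc q) 0F n

-- Prefix counts of a maximal word

module MaximalWord (k : ℕ) (k≥2 : 2 ≤ k) (W : Word (3 * k + 2) 5) (W-maximal : InM2 W)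
  (excess≤emax : (s h′ : ℕ) (p : s + h′ ≤ 3 * k + 2) → 1 ≤ h′ → h′ < 3 * k + 2 →
                 excess (sub W s h′ p) ≤ℚ emax h′ 5)
  where

  H : ℕ
  H = 3 * k + 2

  S : ℕ → ℕ
  S = prefixCount (row W)

  S-split : ∀ s len (le : s + len ≤ H) → S (s + len) ≡ S s + filled (sub W s len le)
  S-split s len le = trans (sumTo-+ s len (population ∘ row W)) (cong (_+_ (S s)) (sym (filled-sub W s len le)))

  S-strip : ∀ s u ρ → s + (3 * u + toℕ ρ) ≤ H → 1 ≤ 3 * u + toℕ ρ → 3 * u + toℕ ρ < H →
            S (s + (3 * u + toℕ ρ)) ≤ S s + (10 * u + surplus u ρ)
  S-strip s u ρ le 1≤len len<H = subst (_≤ S s + _) (sym (S-split s _ le))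
    (+-monoʳ-≤ (S s) (strip-capacity u ρ (sub W s _ le) 1≤len (excess≤emax s _ le 1≤len len<H)))

  S-prefix : ∀ u ρ → 1 ≤ 3 * u + toℕ ρ → 3 * u + toℕ ρ < H → S (3 * u + toℕ ρ) ≤ 10 * u + surplus u ρ
  S-prefix u ρ 1≤len len<H = S-strip 0 u ρ (<⇒≤ len<H) 1≤len len<H

  S-total : S H ≡ 10 * k + 8
  S-total = ≤-antisym upper (subst (10 * k + 8 ≤_) (filled-rows W) (InM2⇒10k+8≤filled k W W-maximal))
    where
    j : ℕ
    j = k ∸ 2
    shape : ∀ j → 4 + (3 * (1 + j) + 1) ≡ 3 * (2 + j) + 2
    shape = solve-∀
    4+[3[1+j]+1]≡H : 4 + (3 * (1 + j) + 1) ≡ H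
    4+[3[1+j]+1]≡H = trans (shape j) (cong (λ k → 3 * k + 2) (m+[n∸m]≡n k≥2))
    total : ∀ j → 14 + (10 * (1 + j) + 4) ≡ 10 * (2 + j) + 8
    total = solve-∀
    upper : S H ≤ 10 * k + 8
    upper = begin
      S H                             ≡⟨ cong S 4+[3[1+j]+1]≡H ⟨
      S (4 + (3 * (1 + j) + 1))       ≤⟨ S-strip 4 (1 + j) 1F (≤-reflexive 4+[3[1+j]+1]≡H) (m≤n+m 1 (3 * (1 + j)))
                                           (subst (3 * (1 + j) + 1 <_) 4+[3[1+j]+1]≡H
                                                  (m<n+m (3 * (1 + j) + 1) {4} (s≤s z≤n))) ⟩
      S 4 + (10 * (1 + j) + 4)        ≤⟨ +-monoˡ-≤ _ (S-prefix 1 1F (s≤s z≤n)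
                                           (subst (4 <_) 4+[3[1+j]+1]≡H (m<m+n 4 (m≤n+m 1 (3 * (1 + j)))))) ⟩
      14 + (10 * (1 + j) + 4)         ≡⟨ total j ⟩
      10 * (2 + j) + 8                ≡⟨ cong (λ k → 10 * k + 8) (m+[n∸m]≡n k≥2) ⟩
      10 * k + 8                      ∎
      where open ≤-Reasoning

  S-suffix : ∀ s u ρ → s + (3 * u + toℕ ρ) ≡ H → 1 ≤ s → 1 ≤ 3 * u + toℕ ρ →
             10 * k + 8 ≤ S s + (10 * u + surplus u ρ)
  S-suffix s u ρ s+len≡H 1≤s 1≤len = subst (_≤ S s + (10 * u + surplus u ρ)) (trans (cong S s+len≡H) S-total)
    (S-strip s u ρ (≤-reflexive s+len≡H) 1≤len
             (subst (3 * u + toℕ ρ <_) s+len≡H (m<n+m (3 * u + toℕ ρ) {s} 1≤s)))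

  S-beyond : ∀ x → H ≤ x → S x ≡ 10 * k + 8
  S-beyond x H≤x = begin
    S x                                                    ≡⟨ cong S (m+[n∸m]≡n H≤x) ⟨
    S (H + (x ∸ H))                                        ≡⟨ sumTo-+ H (x ∸ H) (population ∘ row W) ⟩
    S H + sumTo (x ∸ H) (λ i → population (row W (H + i))) ≡⟨ cong₂ _+_ S-total (sumTo-zero (x ∸ H) empty) ⟩
    10 * k + 8 + 0                                         ≡⟨ +-identityʳ (10 * k + 8) ⟩
    10 * k + 8                                             ∎
    where
    open ≡-Reasoning
    empty : ∀ i → population (row W (H + i)) ≡ 0
    empty i = trans (cong population (row-outside W (H + i) (m≤m+n H i))) (population-emptyRow 5)

  S-last : ∀ t → k ≡ t + 0 → S (3 * t + 2) ≡ 10 * t + 8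
  S-last t k≡t+0 = trans (cong (λ k → S (3 * k + 2)) (sym k≡t)) (trans S-total (cong (λ k → 10 * k + 8) k≡t))
    where
    k≡t : k ≡ t
    k≡t = trans k≡t+0 (+-identityʳ t)

  3t+ρ<H : ∀ t u (ρ : Fin 3) → k ≡ t + u → toℕ ρ < 3 * u + 2 → 3 * t + toℕ ρ < H
  3t+ρ<H t u ρ k≡t+u ρ<3u+2 = subst (3 * t + toℕ ρ <_)
    (trans (sym (split t u)) (cong (λ k → 3 * k + 2) (sym k≡t+u))) (+-monoʳ-< (3 * t) ρ<3u+2)
    where
    split : ∀ t u → 3 * (t + u) + 2 ≡ 3 * t + (3 * u + 2)
    split = solve-∀

  S-upper : ∀ t u (ρ : Fin 3) → k ≡ t + u → S (3 * t + toℕ ρ) ≤ 10 * t + surplus t ρ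
  S-upper t       zero    2F k≡t+0 = ≤-reflexive (S-last t k≡t+0)
  S-upper zero    u       0F _     = z≤n
  S-upper t       (suc u) 2F k≡t+u =
    S-prefix t 2F (≤-trans (s≤s z≤n) (m≤n+m 2 _)) (3t+ρ<H t (suc u) 2F k≡t+u (m<n+m 2 {3 * suc u} (s≤s z≤n)))
  S-upper t       u       1F k≡t+u =
    S-prefix t 1F (m≤n+m 1 _) (3t+ρ<H t u 1F k≡t+u (m≤n+m 2 (3 * u)))
  S-upper (suc t) u       0F k≡t+u =
    S-prefix (suc t) 0F (s≤s z≤n) (3t+ρ<H (suc t) u 0F k≡t+u (≤-trans (n≤1+n 1) (m≤n+m 2 (3 * u))))

  prefix+suffix≡H : ∀ t u (ρ : Fin 3) → k ≡ t + u → (3 * t + toℕ ρ) + (3 * u + toℕ (opposite ρ)) ≡ H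
  prefix+suffix≡H t u ρ k≡t+u = trans (split ρ t u) (cong (λ k → 3 * k + 2) (sym k≡t+u))
    where
    split : ∀ (ρ : Fin 3) t u → (3 * t + toℕ ρ) + (3 * u + toℕ (opposite ρ)) ≡ 3 * (t + u) + 2
    split 0F = solve-∀
    split 1F = solve-∀
    split 2F = solve-∀

  S-lower-by-suffix : ∀ t u (ρ : Fin 3) → k ≡ t + u →
                      1 ≤ 3 * t + toℕ ρ → 1 ≤ 3 * u + toℕ (opposite ρ) →
                      10 * t + (8 ∸ surplus u (opposite ρ)) ≤ S (3 * t + toℕ ρ)
  S-lower-by-suffix t u ρ k≡t+u 1≤x 1≤len = a+[b+n]≤c+[b+s]⇒a+[n∸s]≤c (surplus≤8 u (opposite ρ))
    (subst (_≤ S (3 * t + toℕ ρ) + (10 * u + surplus u (opposite ρ)))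
           (trans (cong (λ k → 10 * k + 8) k≡t+u) (regroup t u))
           (S-suffix (3 * t + toℕ ρ) u (opposite ρ) (prefix+suffix≡H t u ρ k≡t+u) 1≤x 1≤len))
    where
    regroup : ∀ t u → 10 * (t + u) + 8 ≡ 10 * t + (10 * u + 8)
    regroup = solve-∀

  S-lower : ∀ t u (ρ : Fin 3) → k ≡ t + u → 10 * t + (8 ∸ surplus u (opposite ρ)) ≤ S (3 * t + toℕ ρ)
  S-lower zero    u       0F _     = z≤n
  S-lower t       zero    2F k≡t+0 = ≤-reflexive (sym (S-last t k≡t+0))
  S-lower (suc t) u       0F k≡t+u =
    S-lower-by-suffix (suc t) u 0F k≡t+u (s≤s z≤n) (≤-trans (n≤1+n 1) (m≤n+m 2 (3 * u)))
  S-lower t       u       1F k≡t+u =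
    S-lower-by-suffix t u 1F k≡t+u (m≤n+m 1 (3 * t)) (m≤n+m 1 (3 * u))
  S-lower t       (suc u) 2F k≡t+u =
    S-lower-by-suffix t (suc u) 2F k≡t+u (≤-trans (n≤1+n 1) (m≤n+m 2 (3 * t))) (s≤s z≤n)

  allowed-sound : ∀ m d q (ρ : Fin 3) o → k ≡ m + d →
                  S (3 * (q + m) + toℕ ρ) ≡ 10 * m + o → T (allowed m d q ρ o)
  allowed-sound m d q ρ o k≡m+d count = by-cases (d <ᵇ q) refl
    where
    by-cases : ∀ b → (d <ᵇ q) ≡ b → T ((if b then exactly (10 * d + 8) else stripBounds m d q ρ) o)
    by-cases true d<ᵇq = exactly-intro (sym o≡)
      where
      regroup : ∀ m d → 3 * (m + d) + 3 ≡ 3 * (suc d + m)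
      regroup = solve-∀
      beyond : H ≤ 3 * (q + m) + toℕ ρ
      beyond = begin
        H                       ≡⟨ cong (λ k → 3 * k + 2) k≡m+d ⟩
        3 * (m + d) + 2         ≤⟨ +-monoʳ-≤ (3 * (m + d)) (n≤1+n 2) ⟩
        3 * (m + d) + 3         ≡⟨ regroup m d ⟩
        3 * (suc d + m)         ≤⟨ *-monoʳ-≤ 3 (+-monoˡ-≤ m (<ᵇ⇒< d q (subst T (sym d<ᵇq) tt))) ⟩
        3 * (q + m)             ≤⟨ m≤m+n (3 * (q + m)) (toℕ ρ) ⟩
        3 * (q + m) + toℕ ρ     ∎
        where open ≤-Reasoning
      total : ∀ m d → 10 * (m + d) + 8 ≡ 10 * m + (10 * d + 8)
      total = solve-∀
      o≡ : o ≡ 10 * d + 8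
      o≡ = +-cancelˡ-≡ (10 * m) o (10 * d + 8)
             (trans (sym count) (trans (S-beyond _ beyond) (trans (cong (λ k → 10 * k + 8) k≡m+d) (total m d))))
    by-cases false d≮ᵇq =
      between-intro (+-cancelˡ-≤ (10 * m) (10 * q + lo) o (subst₂ _≤_ (shift q m lo) count lower))
                    (+-cancelˡ-≤ (10 * m) o (10 * q + hi) (subst₂ _≤_ count (shift q m hi) upper))
      where
      q≤d : q ≤ d
      q≤d = ≮⇒≥ λ d<q → subst T d≮ᵇq (<⇒<ᵇ d<q)
      shuffle : ∀ m q u → m + (q + u) ≡ (q + m) + u
      shuffle = solve-∀
      k≡t+u : k ≡ (q + m) + (d ∸ q)
      k≡t+u = trans k≡m+d (trans (cong (_+_ m) (sym (m+[n∸m]≡n q≤d))) (shuffle m q (d ∸ q)))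
      shift : ∀ q m c → 10 * (q + m) + c ≡ 10 * m + (10 * q + c)
      shift = solve-∀
      lo hi : ℕ
      lo = 8 ∸ surplus (d ∸ q) (opposite ρ)
      hi = surplus (q + m) ρ
      lower : 10 * (q + m) + lo ≤ S (3 * (q + m) + toℕ ρ)
      lower = S-lower (q + m) (d ∸ q) ρ k≡t+u
      upper : S (3 * (q + m) + toℕ ρ) ≤ 10 * (q + m) + hi
      upper = S-upper (q + m) (d ∸ q) ρ k≡t+u

  allowed-at : ∀ {m d} q ρ x → k ≡ m + d → x ≡ 3 * (q + m) + toℕ ρ →
               ∀ o → S x ≡ 10 * m + o → T (allowed m d q ρ o)
  allowed-at {m} {d} q ρ x k≡m+d x≡ o count = allowed-sound m d q ρ o k≡m+d (trans (cong S (sym x≡)) count)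

  window-sound : ∀ m d q ρ n x → k ≡ m + d → x ≡ 3 * (q + m) + toℕ ρ →
                 Within (row W) (10 * m) x (window m d q ρ n)
  window-sound m d q ρ  zero    x _     _  = tt
  window-sound m d q 0F (suc n) x k≡m+d x≡ =
    allowed-at q 0F x k≡m+d x≡ , window-sound m d q 1F n (suc x) k≡m+d (trans (cong suc x≡) (sym (+-suc _ 0)))
  window-sound m d q 1F (suc n) x k≡m+d x≡ =
    allowed-at q 1F x k≡m+d x≡ , window-sound m d q 2F n (suc x) k≡m+d (trans (cong suc x≡) (sym (+-suc _ 1)))
  window-sound m d q 2F (suc n) x k≡m+d x≡ =
    allowed-at q 2F x k≡m+d x≡ , window-sound m d (suc q) 0F n (suc x) k≡m+d (trans (cong suc x≡) (carry q m))
    where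
    carry : ∀ q m → suc (3 * (q + m) + 2) ≡ 3 * (suc q + m) + 0
    carry = solve-∀

  row-valid : ∀ x → T (rowValid (rowAbove (row W) x) (row W x) (row W (suc x)))
  row-valid = InW2⇒rowValid W (proj₁ W-maximal)

  Pinned : ℕ → Set
  Pinned t = S (3 * t + 2) ≡ 10 * t + 7

  top-window-extensible : ∀ d n i v → k ≡ d → S (i + 1) ≢ v →
                          T (extensible (refine i (except v) (window 0 d 0 1F n)) nothing (just emptyRow) 0)
  top-window-extensible d n i v k≡d S≢v =
    extensible-complete (row W) row-valid 0 _ nothing (just emptyRow) 0 0 refl tt (row-valid 0)
      (within-refine (row W) 0 1 i (except v) _ (window-sound 0 d 0 1F n 1 k≡d refl)
        λ o count → except-intro λ v≡o → S≢v (trans count (sym v≡o)))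

  -- In every case below T (extensible …) evaluates to ⊥: the search finds no rows filling the
  -- window, and each window is the shortest for which this happens.
  pinned-1 : Pinned 1
  pinned-1 = decidable-stable (S 5 ≟ 17) (by-height k refl)
    where
    by-height : ∀ d → k ≡ d → ¬ ¬ Pinned 1
    by-height 2                         k≡2   ¬P = top-window-extensible 2 9 4 17 k≡2 ¬P
    by-height 3                         k≡3   ¬P = top-window-extensible 3 11 4 17 k≡3 ¬P
    by-height (suc (suc (suc (suc r)))) k≡4+r ¬P = top-window-extensible (4 + r) 8 4 17 k≡4+r ¬P
    by-height 0                         k≡0      = contradiction (subst (2 ≤_) k≡0 k≥2) λ ()
    by-height 1                         k≡1      = contradiction (subst (2 ≤_) k≡1 k≥2) λ { (s≤s ()) }

  pinned-2 : 3 ≤ k → Pinned 2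
  pinned-2 k≥3 = decidable-stable (S 8 ≟ 27) (by-height k refl)
    where
    by-height : ∀ d → k ≡ d → ¬ ¬ Pinned 2
    by-height 3                               k≡3   ¬P = top-window-extensible 3 12 7 27 k≡3 ¬P
    by-height 4                               k≡4   ¬P = top-window-extensible 4 14 7 27 k≡4 ¬P
    by-height (suc (suc (suc (suc (suc r))))) k≡5+r ¬P = top-window-extensible (5 + r) 11 7 27 k≡5+r ¬P
    by-height 0                               k≡0      = contradiction (subst (3 ≤_) k≡0 k≥3) λ ()
    by-height 1                               k≡1      = contradiction (subst (3 ≤_) k≡1 k≥3) λ { (s≤s ()) }
    by-height 2                               k≡2      =
      contradiction (subst (3 ≤_) k≡2 k≥3) λ { (s≤s (s≤s ())) }

  count-unique : ∀ x {base o c} → S x ≡ base + o → S x ≡ base + c → o ≡ c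
  count-unique x {base} {o} {c} count count′ = +-cancelˡ-≡ base o c (trans (sym count) count′)

  step-window-extensible : ∀ m d n → k ≡ suc m + d → Pinned (1 + m) → Pinned (2 + m) → ¬ Pinned (3 + m) →
                           T (extensible (refine 5 (except 27) (refine 2 (exactly 17) (window (suc m) d 1 0F n)))
                                         nothing nothing 7)
  step-window-extensible m d n k≡ P₁ P₂ ¬P₃ =
    extensible-complete (row W) row-valid (10 * suc m) _ nothing nothing x₀ 7 P₁ tt tt
      (within-refine (row W) _ (suc x₀) 5 (except 27) _
        (within-refine (row W) _ (suc x₀) 2 (exactly 17) _
          (window-sound (suc m) d 1 0F n (suc x₀) k≡ (next m))
          exactly-17)
        except-27)
    where
    x₀ : ℕ
    x₀ = 3 * suc m + 2
    next : ∀ m → suc (3 * suc m + 2) ≡ 3 * (1 + suc m) + 0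
    next = solve-∀
    middle : ∀ m → 2 + suc (3 * suc m + 2) ≡ 3 * (2 + m) + 2
    middle = solve-∀
    value17 : ∀ m → 10 * (2 + m) + 7 ≡ 10 * suc m + 17
    value17 = solve-∀
    exactly-17 : ∀ o → S (2 + suc x₀) ≡ 10 * suc m + o → T (exactly 17 o)
    exactly-17 o count = exactly-intro {17} {o}
      (sym (count-unique (2 + suc x₀) {10 * suc m} count (trans (cong S (middle m)) (trans P₂ (value17 m)))))
    target : ∀ m → 3 * (3 + m) + 2 ≡ 5 + suc (3 * suc m + 2)
    target = solve-∀
    value27 : ∀ m → 10 * suc m + 27 ≡ 10 * (3 + m) + 7
    value27 = solve-∀
    except-27 : ∀ o → S (5 + suc x₀) ≡ 10 * suc m + o → T (except 27 o)
    except-27 o count = except-intro λ 27≡o →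
      ¬P₃ (trans (cong S (target m)) (trans count (trans (cong (_+_ (10 * suc m)) (sym 27≡o)) (value27 m))))

  pinned-step : ∀ m → 3 + m < k → Pinned (1 + m) → Pinned (2 + m) → Pinned (3 + m)
  pinned-step m 3+m<k P₁ P₂ = decidable-stable (S (3 * (3 + m) + 2) ≟ 10 * (3 + m) + 7) (by-depth (k ∸ suc m) k≡)
    where
    k≡ : k ≡ suc m + (k ∸ suc m)
    k≡ = sym (m+[n∸m]≡n (≤-trans (m≤n+m (suc m) 2) (<⇒≤ 3+m<k)))
    shallow : ∀ d → d ≤ 2 → k ≢ suc m + d
    shallow d d≤2 k≡ = <⇒≱ 3+m<k (begin
      k          ≡⟨ k≡ ⟩
      suc m + d  ≤⟨ +-monoʳ-≤ (suc m) d≤2 ⟩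
      suc m + 2  ≡⟨ +-comm (suc m) 2 ⟩
      3 + m      ∎)
      where open ≤-Reasoning
    by-depth : ∀ d → k ≡ suc m + d → ¬ ¬ Pinned (3 + m)
    by-depth 3                               k≡ ¬P₃ = step-window-extensible m 3 10 k≡ P₁ P₂ ¬P₃
    by-depth 4                               k≡ ¬P₃ = step-window-extensible m 4 12 k≡ P₁ P₂ ¬P₃
    by-depth (suc (suc (suc (suc (suc r))))) k≡ ¬P₃ = step-window-extensible m (5 + r) 9 k≡ P₁ P₂ ¬P₃
    by-depth 0                               k≡     = contradiction k≡ (shallow 0 z≤n)
    by-depth 1                               k≡     = contradiction k≡ (shallow 1 (s≤s z≤n))
    by-depth 2                               k≡     = contradiction k≡ (shallow 2 ≤-refl)

  pinned : ∀ t → 1 ≤ t → t < k → Pinned t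
  pinned 1                   _ _     = pinned-1
  pinned 2                   _ 2<k   = pinned-2 2<k
  pinned (suc (suc (suc m))) _ 3+m<k =
    pinned-step m 3+m<k (pinned (suc m) (s≤s z≤n) 1+m<k) (pinned (suc (suc m)) (s≤s z≤n) 2+m<k)
    where
    2+m<k : 2 + m < k
    2+m<k = <-trans (n<1+n (2 + m)) 3+m<k
    1+m<k : 1 + m < k
    1+m<k = <-trans (n<1+n (1 + m)) 2+m<k

  filled-between : ∀ s len (le : s + len ≤ H) {a b} → S s ≡ a → S (s + len) ≡ a + b →
                   filled (sub W s len le) ≡ b
  filled-between s len le {a} {b} Sₛ Sₛ₊ₗ =
    +-cancelˡ-≡ a _ b (trans (cong (_+ filled (sub W s len le)) (sym Sₛ)) (trans (sym (S-split s len le)) Sₛ₊ₗ))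

  interior-excess : ∀ m → 1 ≤ m → m + 2 ≤ k → (p : (3 * m + 2) + 3 ≤ H) →
                    excess (sub W (3 * m + 2) 3 p) ≡ ℚ.0ℚ
  interior-excess m m≥1 m+2≤k p = cong (λ n → (+ n / 1) -ℚ (+ 30 / 3))
    (filled-between (3 * m + 2) 3 p (pinned m m≥1 m<k)
                    (trans (cong S (next m)) (trans (pinned (suc m) (s≤s z≤n) 1+m<k) (value m))))
    where
    1+m<k : suc m < k
    1+m<k = subst (_≤ k) (+-comm m 2) m+2≤k
    m<k : m < k
    m<k = <-trans (n<1+n m) 1+m<k
    next : ∀ m → (3 * m + 2) + 3 ≡ 3 * suc m + 2
    next = solve-∀
    value : ∀ m → 10 * suc m + 7 ≡ (10 * m + 7) + 10
    value = solve-∀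

  first-excess : (p : 0 + 5 ≤ H) → excess (sub W 0 5 p) ≡ + 1 / 3
  first-excess p = cong (λ n → (+ n / 1) -ℚ (+ 50 / 3)) (filled-between 0 5 p refl (pinned 1 (s≤s z≤n) k≥2))

  last-excess : (p : (3 * k ∸ 1) + 3 ≤ H) → excess (sub W (3 * k ∸ 1) 3 p) ≡ + 1 / 1
  last-excess p = cong (λ n → (+ n / 1) -ℚ (+ 30 / 3))
    (filled-between (3 * k ∸ 1) 3 p (trans (cong S start) (pinned j j≥1 j<k)) (trans (cong S end) (trans S-total total)))
    where
    j : ℕ
    j = k ∸ 1
    k≡1+j : k ≡ 1 + j
    k≡1+j = sym (m+[n∸m]≡n (≤-trans (n≤1+n 1) k≥2))
    j≥1 : 1 ≤ j
    j≥1 = +-cancelˡ-≤ 1 1 j (subst (2 ≤_) k≡1+j k≥2)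
    j<k : j < k
    j<k = subst (j <_) (sym k≡1+j) (n<1+n j)
    3[1+j]≡ : ∀ j → 3 * (1 + j) ≡ suc (3 * j + 2)
    3[1+j]≡ = solve-∀
    start : 3 * k ∸ 1 ≡ 3 * j + 2
    start = cong (_∸ 1) (trans (cong (3 *_) k≡1+j) (3[1+j]≡ j))
    [3j+2]+3≡ : ∀ j → (3 * j + 2) + 3 ≡ 3 * (1 + j) + 2
    [3j+2]+3≡ = solve-∀
    end : (3 * k ∸ 1) + 3 ≡ H
    end = trans (cong (_+ 3) start) (trans ([3j+2]+3≡ j) (cong (λ k → 3 * k + 2) (sym k≡1+j)))
    10[1+j]+8≡ : ∀ j → 10 * (1 + j) + 8 ≡ (10 * j + 7) + 11
    10[1+j]+8≡ = solve-∀
    total : 10 * k + 8 ≡ (10 * j + 7) + 11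
    total = trans (cong (λ k → 10 * k + 8) k≡1+j) (10[1+j]+8≡ j)

corollary4 : (k : ℕ) → 2 ≤ k → (W : Word (3 * k + 2) 5) → InM2 W
    → ((s h' : ℕ) (p : s + h' ≤ 3 * k + 2) → 1 ≤ h' → h' < 3 * k + 2
        → excess (sub W s h' p) ≤ℚ emax h' 5)
    → ((m : ℕ) → 1 ≤ m → m + 2 ≤ k → (p : (3 * m + 2) + 3 ≤ 3 * k + 2)
        → ¬ (1ℚ ≤ℚ excess (sub W (3 * m + 2) 3 p)))
      × ((p : 0 + 5 ≤ 3 * k + 2) → excess (sub W 0 5 p) ≡ + 1 / 3)
      × ((p : (3 * k ∸ 1) + 3 ≤ 3 * k + 2) → excess (sub W (3 * k ∸ 1) 3 p) ≡ + 1 / 1)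
      × ((m : ℕ) → 1 ≤ m → m + 2 ≤ k → (p : (3 * m + 2) + 3 ≤ 3 * k + 2)
        → excess (sub W (3 * m + 2) 3 p) ≢ -[1+ 0 ] / 1)
corollary4 k k≥2 W W-maximal excess≤emax =
    (λ m m≥1 m+2≤k p → subst (λ e → ¬ (1ℚ ≤ℚ e)) (sym (interior-excess m m≥1 m+2≤k p)) 1ℚ≰0ℚ)
  , first-excess
  , last-excess
  , (λ m m≥1 m+2≤k p → subst (_≢ -[1+ 0 ] / 1) (sym (interior-excess m m≥1 m+2≤k p)) λ ())
  where
  open MaximalWord k k≥2 W W-maximal excess≤emax
  1ℚ≰0ℚ : ¬ (1ℚ ≤ℚ ℚ.0ℚ)
  1ℚ≰0ℚ (ℚ.*≤* (ℤ.+≤+ ()))
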